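{- Let $G$ be a finite, undirected, simple, connected graph. Then the following are equivalent: (i) $G \in \mathbf{WTW}/\mathbf{m_3}$; (ii) $G \in \mathbf{TW}/\mathbf{m_3}$; (iii) $G$ is HHD-free. That is, $\mathbf{WTW}/\mathbf{m_3}=\mathbf{TW}/\mathbf{m_3}=\text{HHD-free}$.
   Context: All graphs are finite, undirected, simple and connected. A $uv$-walk is a sequence of (not necessarily distinct) vertices $W: u=v_0,v_1,\ldots,v_n=v$ with $v_{i-1}$ adjacent to $v_i$ for all $i\in\{1,\ldots,n\}$; $v_1,\ldots,v_{n-1}$ are its internal vertices and $n$ is its length. A $uv$-path is a $uv$-walk with distinct vertices. A $uv$-induced path is a $uv$-path in which two vertices are adjacent in $G$ if and only if they are consecutive on the path. For non-adjacent vertices $u,v$: - $\mathbf{m_3}(u,v)$ is the set of $uv$-$m_3$ paths, i.e. $uv$-induced paths of length at least three. - $\mathbf{WTW}(u,v)$ is the set of $uv$-weakly toll walks: $uv$-walks $u,v_1,\ldots,v_{k-1},v$ such that, among the vertices of the walk, $u$ is adjacent only to the vertex $v_1$ and $v$ is adjacent only to the vertex $v_{k-1}$ (the vertices $v_1$ and $v_{k-1}$ may be repeated in the walk). - $\mathbf{TW}(u,v)$ is the set of $uv$-toll walks: $uv$-walks $u,v_1,\ldots,v_{k-1},v$ such that, among the vertices of the walk, $u$ is adjacent only to $v_1$ and $v$ is adjacent only to $v_{k-1}$, and moreover $\{v_1\}\cap\{v_2,\ldots,v_{k-1}\}=\emptyset$ and $\{v_{k-1}\}\cap\{v_1,\ldots,v_{k-2}\}=\emptyset$.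 Domination: for non-adjacent $u,v$, a $uv$-walk $W$ dominates a $uv$-walk $W'$ if every internal vertex of $W'$ is adjacent to some internal vertex of $W$ or belongs to $W$. The class $\mathbf{A}/\mathbf{B}$ consists of all graphs $G$ such that for every pair of non-adjacent vertices $u,v$ of $G$, every walk $W\in\mathbf{A}(u,v)$ dominates every walk $W'\in\mathbf{B}(u,v)$ (vacuously true if one of the sets is empty). A hole is a chordless cycle with at least five vertices. A house is the complement of an induced path with five vertices. A domino is the graph obtained from the chordless cycle $x_0,x_1,\ldots,x_5$ by adding the chord $x_1x_4$. A graph is HHD-free if it contains no house, no hole and no domino as an induced subgraph. -}

module Defs where

open import Data.Fin using (Fin; toℕ; fromℕ; inject₁; #_; zero; suc)
open import Data.Fin.Properties using () renaming (_≟_ to _≟ᶠ_)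
open import Data.Nat using (ℕ; zero; suc; _≤_; _<_; z≤n; s≤s; _≟_)
open import Data.Nat.Properties using (1+n≢n; ≤-trans; m≤m+n)
open import Data.Product using (Σ; ∃; _×_; _,_)
open import Data.Sum using (_⊎_; inj₁; inj₂; swap; [_,_]′)
open import Function.Bundles using (_⇔_)
open import Function.Definitions using (Injective)
open import Level using (0ℓ)
open import Relation.Binary.Core using (Rel)
open import Relation.Binary.Definitions using (Decidable; Irreflexive; Symmetric)
open import Relation.Binary.PropositionalEquality using (_≡_; _≢_; refl; sym; trans)
open import Relation.Nullary using (¬_)
open import Relation.Nullary.Decidable using (_×-dec_; _⊎-dec_; ¬?)

record Graph (n : ℕ) : Set₁ where
  infix 4 _~_
  field
    _~_      : Rel (Fin n) 0ℓ
    ~-sym    : Symmetric _~_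
    ~-irrefl : Irreflexive _≡_ _~_
    _~?_     : Decidable _~_

Consecutive : ∀ {k} → Rel (Fin k) 0ℓ
Consecutive i j = suc (toℕ i) ≡ toℕ j ⊎ suc (toℕ j) ≡ toℕ i

module _ {n : ℕ} (G : Graph n) where
  open Graph G

  record Walk (u v : Fin n) : Set where
    field
      length : ℕ
      vertex : Fin (suc length) → Fin n
      start  : vertex zero ≡ u
      end    : vertex (fromℕ length) ≡ v
      step   : ∀ i → vertex (inject₁ i) ~ vertex (suc i)

  Connected : Set
  Connected = ∀ u v → Walk u v

module _ {n : ℕ} {G : Graph n} {u v : Fin n} (W : Walk G u v) where
  open Graph G
  open Walk W

  OnWalk : Fin n → Set
  OnWalk x = ∃ λ i → vertex i ≡ x

  Internal : Fin n → Set
  Internal x = ∃ λ i → 0 < toℕ i × toℕ i < length × vertex i ≡ x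

  IsPath : Set
  IsPath = Injective _≡_ _≡_ vertex

  IsInducedPath : Set
  IsInducedPath = IsPath × (∀ i j → vertex i ~ vertex j ⇔ Consecutive i j)

  Ism₃ : Set
  Ism₃ = IsInducedPath × 3 ≤ length

  -- In the next two definitions i ranges over the positions of the walk, and j
  -- is the position 1 or length - 1. Both exist when u and v are distinct and
  -- non-adjacent, since then length ≥ 2.
  IsWeaklyToll : Set
  IsWeaklyToll =
      (∀ i j → toℕ j ≡ 1            → u ~ vertex i → vertex i ≡ vertex j)
    × (∀ i j → suc (toℕ j) ≡ length → v ~ vertex i → vertex i ≡ vertex j)

  IsToll : Set
  IsToll =
      IsWeaklyToll
    × (∀ i j → toℕ j ≡ 1 → 2 ≤ toℕ i → toℕ i < length → vertex i ≢ vertex j)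
    × (∀ i j → suc (toℕ j) ≡ length → 1 ≤ toℕ i → suc (toℕ i) < length →
         vertex i ≢ vertex j)

Dominates : ∀ {n} {G : Graph n} {u v : Fin n} → Rel (Walk G u v) 0ℓ
Dominates {G = G} W W′ =
  ∀ x → Internal W′ x → (∃ λ y → Internal W y × Graph._~_ G x y) ⊎ OnWalk W x

WalkKind : Set₁
WalkKind = ∀ {n} {G : Graph n} {u v : Fin n} → Walk G u v → Set

m₃ WTW TW : WalkKind
m₃  = Ism₃
WTW = IsWeaklyToll
TW  = IsToll

infix 4 _∈_/_
_∈_/_ : ∀ {n} → Graph n → WalkKind → WalkKind → Set
G ∈ A / B =
  ∀ u v → u ≢ v → ¬ Graph._~_ G u v →
  (W W′ : Walk G u v) → A W → B W′ → Dominates W W′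

infix 4 _⊑_
_⊑_ : ∀ {m n} → Graph m → Graph n → Set
_⊑_ {m} {n} H G =
  Σ (Fin m → Fin n) λ f →
    Injective _≡_ _≡_ f × (∀ i j → Graph._~_ H i j ⇔ Graph._~_ G (f i) (f j))

complement : ∀ {n} → Graph n → Graph n
complement G = record
  { _~_      = λ i j → i ≢ j × ¬ i ~ j
  ; ~-sym    = λ (i≢j , i≁j) → (λ j≡i → i≢j (sym j≡i)) , (λ j~i → i≁j (~-sym j~i))
  ; ~-irrefl = λ i≡j (i≢j , _) → i≢j i≡j
  ; _~?_     = λ i j → ¬? (i ≟ᶠ j) ×-dec ¬? (i ~? j)
  }
  where open Graph G

addEdge : ∀ {n} (G : Graph n) (a b : Fin n) → a ≢ b → Graph n
addEdge G a b a≢b = record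
  { _~_      = λ i j → i ~ j ⊎ (i ≡ a × j ≡ b ⊎ i ≡ b × j ≡ a)
  ; ~-sym    = λ { (inj₁ i~j)              → inj₁ (~-sym i~j)
                 ; (inj₂ (inj₁ (p , q))) → inj₂ (inj₂ (q , p))
                 ; (inj₂ (inj₂ (p , q))) → inj₂ (inj₁ (q , p)) }
  ; ~-irrefl = λ { i≡j  (inj₁ i~j)                   → ~-irrefl i≡j i~j
                 ; refl (inj₂ (inj₁ (i≡a , i≡b))) → a≢b (trans (sym i≡a) i≡b)
                 ; refl (inj₂ (inj₂ (i≡b , i≡a))) → a≢b (trans (sym i≡a) i≡b) }
  ; _~?_     = λ i j → (i ~? j)
                 ⊎-dec ((i ≟ᶠ a ×-dec j ≟ᶠ b) ⊎-dec (i ≟ᶠ b ×-dec j ≟ᶠ a))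
  }
  where open Graph G

pathGraph : ∀ k → Graph k
pathGraph k = record
  { _~_      = Consecutive
  ; ~-sym    = swap
  ; ~-irrefl = λ { refl → [ 1+n≢n , 1+n≢n ]′ }
  ; _~?_     = λ i j → (suc (toℕ i) ≟ toℕ j) ⊎-dec (suc (toℕ j) ≟ toℕ i)
  }

cycleGraph : ∀ k → 3 ≤ k → Graph k
cycleGraph (suc zero)    (s≤s ())
cycleGraph (suc (suc k)) _ =
  addEdge (pathGraph (suc (suc k))) zero (fromℕ (suc k)) (λ ())

hole : ∀ k → 5 ≤ k → Graph k
hole k 5≤k = cycleGraph k (≤-trans (m≤m+n 3 2) 5≤k)

house : Graph 5
house = complement (pathGraph 5)

domino : Graph 6
domino = addEdge (cycleGraph 6 (s≤s (s≤s (s≤s z≤n)))) (# 1) (# 4) (λ ())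

HHDFree : ∀ {n} → Graph n → Set
HHDFree G =
    ¬ house ⊑ G
  × (∀ k (5≤k : 5 ≤ k) → ¬ hole k 5≤k ⊑ G)
  × ¬ domino ⊑ G

{-# OPTIONS --safe #-}

-- (iii) ⇒ (i): let Q = q₀ … q_l be an induced path of length at least three and
-- W a walk between its ends that does not dominate x = q_i; up to reversal,
-- i + 2 ≤ l.  Following Q back from w = q_(i-1) to q₀, then W, then Q back from
-- q_l to t = q_(i+2) gives a walk which meets N[x] only in w, and from which an
-- induced path w = r₀, r₁, …, r_m = t can be extracted.  Put y = q_(i+1).  The
-- first neighbour of y on this path is r₁, otherwise x, w, r₁, … and y form a
-- hole.  If its next neighbour is r₂, then w, x, y, r₁, r₂ induce a house; if it
-- is r₃, there is a domino; if it comes later, there is again a hole.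
--
-- (ii) ⇒ (iii): in a house, hole or domino, some induced path of length at least
-- three has an internal vertex which is not dominated by a common neighbour of
-- the ends.

module Submission where

open import Defs
open import Data.Bool using (if_then_else_)
open import Data.Empty using (⊥; ⊥-elim)
open import Data.Fin using (Fin; toℕ; fromℕ; fromℕ<; inject; inject₁; zero; suc; #_)
import Data.Fin as F
open import Data.Fin.Properties
  using (toℕ-injective; toℕ-fromℕ; toℕ-fromℕ<; toℕ-inject; toℕ-inject₁;
         inject₁-injective; fromℕ≢inject₁; toℕ≤pred[n]; toℕ<n; any?; all?)
  renaming (_≟_ to _≟ᶠ_; <-cmp to <ᶠ-cmp; suc-injective to sucᶠ-injective)
open import Data.Nat
  using (ℕ; zero; suc; _+_; _∸_; _≤_; _<_; z≤n; s≤s; z<s; _≟_; _≤?_; _<?_; _≤′_; ≤′-refl; ≤′-step)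
open import Data.Nat.Properties
open import Data.Product using (∃; _×_; _,_; proj₁; proj₂)
open import Data.Sum using (_⊎_; inj₁; inj₂; [_,_]′)
open import Data.Vec using ([]; _∷_; lookup)
open import Function using (_∘_)
open import Function.Bundles using (_⇔_; mk⇔; Equivalence)
open import Relation.Binary.Construct.Closure.ReflexiveTransitive
  using (Star; ε; _◅_; _◅◅_; reverse; map)
open import Relation.Binary.Definitions using (tri<; tri≈; tri>)
open import Relation.Binary.PropositionalEquality
  using (_≡_; _≢_; refl; sym; trans; cong; subst; subst₂)
open import Relation.Nullary using (¬_; Dec; yes; no; does; contradiction)
open import Relation.Nullary.Decidable using (True; toWitness; from-yes; from-no; _×-dec_; _→-dec_)

open Equivalence using (to; from)

-- Embeddings

⊑-trans : ∀ {k m n} {F : Graph k} {H : Graph m} {G : Graph n} → F ⊑ H → H ⊑ G → F ⊑ G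
⊑-trans (f , f-inj , f-adj) (g , g-inj , g-adj) =
  g ∘ f , f-inj ∘ g-inj ,
  λ i j → mk⇔ (to (g-adj _ _) ∘ to (f-adj i j)) (from (f-adj i j) ∘ from (g-adj _ _))

-- Injectivity and both directions of adjacency are bundled pairwise, so that for concrete graphs
-- evaluation settles the whole question.
embeds? : ∀ {m n} (H : Graph m) (G : Graph n) (f : Fin m → Fin n) →
  Dec (∀ i j → (f i ≡ f j → i ≡ j)
             × (Graph._~_ H i j → Graph._~_ G (f i) (f j))
             × (Graph._~_ G (f i) (f j) → Graph._~_ H i j))
embeds? H G f = all? λ i → all? λ j →
  ((f i ≟ᶠ f j) →-dec (i ≟ᶠ j)) ×-dec
  (Graph._~?_ H i j →-dec Graph._~?_ G (f i) (f j)) ×-dec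
  (Graph._~?_ G (f i) (f j) →-dec Graph._~?_ H i j)

decide-⊑ : ∀ {m n} (H : Graph m) (G : Graph n) (f : Fin m → Fin n) →
  True (embeds? H G f) → H ⊑ G
decide-⊑ H G f t =
  f , (λ {i} {j} → proj₁ (e i j)) ,
  λ i j → mk⇔ (proj₁ (proj₂ (e i j))) (proj₂ (proj₂ (e i j)))
  where e = toWitness {a? = embeds? H G f} t

-- Forbidden subgraphs violate TW / m₃

-- The omitted vertex 4 is adjacent to both ends 2 and 1 of the path but not to 3.
path⊑house : pathGraph 4 ⊑ house
path⊑house = decide-⊑ (pathGraph 4) house (lookup (# 2 ∷ # 0 ∷ # 3 ∷ # 1 ∷ [])) _

-- The omitted vertex 1 is adjacent to both ends 0 and 2 of the path but not to 5.
path⊑domino : pathGraph 5 ⊑ domino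
path⊑domino = decide-⊑ (pathGraph 5) domino (lookup (# 0 ∷ # 5 ∷ # 4 ∷ # 3 ∷ # 2 ∷ [])) _

path⊑cycle : ∀ k 3≤k → pathGraph (suc k) ⊑ cycleGraph (suc (suc k)) 3≤k
path⊑cycle k 3≤k = inject₁ , inject₁-injective , λ i j → mk⇔ (inj₁ ∘ shift i j) (unshift i j)
  where
  shift : ∀ i j → Consecutive i j → Consecutive (inject₁ i) (inject₁ j)
  shift i j rewrite toℕ-inject₁ i | toℕ-inject₁ j = λ c → c

  unshift : ∀ (i j : Fin (suc k)) →
    Graph._~_ (cycleGraph (suc (suc k)) 3≤k) (inject₁ i) (inject₁ j) → Consecutive i j
  unshift i j (inj₁ c) rewrite toℕ-inject₁ i | toℕ-inject₁ j = c
  unshift i j (inj₂ (inj₁ (_ , e))) = contradiction (sym e) fromℕ≢inject₁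
  unshift i j (inj₂ (inj₂ (e , _))) = contradiction (sym e) fromℕ≢inject₁

least : ∀ {D : ℕ → Set} {m} → (∀ k → Dec (D k)) → D m →
  ∃ λ j → j ≤ m × D j × (∀ {k} → k < j → ¬ D k)
least {m = zero}  D? Dm = zero , z≤n , Dm , λ ()
least {m = suc m} D? Dm with D? 0
... | yes D0 = zero , z≤n , D0 , λ ()
... | no ¬D0 with least (D? ∘ suc) Dm
...   | j , j≤m , Dj , ¬D = suc j , s≤s j≤m , Dj , λ { {zero} _ → ¬D0 ; {suc k} (s≤s k<j) → ¬D k<j }

module _ {n : ℕ} {G : Graph n} where
  open Graph G

  twoStep : ∀ {u c v} → u ~ c → c ~ v → Walk G u v
  twoStep {u} {c} {v} u~c c~v = record
    { length = 2
    ; vertex = lookup (u ∷ c ∷ v ∷ [])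
    ; start  = refl
    ; end    = refl
    ; step   = λ { zero → u~c ; (suc zero) → c~v }
    }

  -- With a single internal position the non-repetition conditions are vacuous.
  twoStep-toll : ∀ {u c v} (u~c : u ~ c) (c~v : c ~ v) → ¬ u ~ v → IsToll (twoStep u~c c~v)
  twoStep-toll {u} {c} {v} u~c c~v u≁v = (first , last) ,
    (λ _ _ _ 2≤i i<2 → contradiction i<2 (≤⇒≯ 2≤i)) ,
    (λ _ _ _ 1≤i 1+i<2 → contradiction 1+i<2 (≤⇒≯ (s≤s 1≤i)))
    where
    p : Fin 3 → Fin n
    p = lookup (u ∷ c ∷ v ∷ [])

    first : ∀ (i j : Fin 3) → toℕ j ≡ 1 → u ~ p i → p i ≡ p j
    first zero             _          _ u~u = contradiction u~u (~-irrefl refl)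
    first (suc zero)       (suc zero) _ _   = refl
    first (suc (suc zero)) _          _ u~v = contradiction u~v u≁v

    last : ∀ (i j : Fin 3) → suc (toℕ j) ≡ 2 → v ~ p i → p i ≡ p j
    last zero             _          _ v~u = contradiction (~-sym v~u) u≁v
    last (suc zero)       (suc zero) _ _   = refl
    last (suc (suc zero)) _          _ v~v = contradiction v~v (~-irrefl refl)

  -- The walk through `c` is a toll walk whose only internal vertex is `c`, and internal vertices of
  -- the path differ from its ends, so only `c` can dominate them.
  common-neighbour-dominates : G ∈ TW / m₃ →
    ∀ {m} (e : pathGraph (suc m) ⊑ G) → 3 ≤ m →
    ∀ {c} → proj₁ e zero ~ c → c ~ proj₁ e (fromℕ m) →
    ∀ i → 0 < toℕ i → toℕ i < m → proj₁ e i ~ c ⊎ proj₁ e i ≡ c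
  common-neighbour-dominates G∈ {m} (f , inj , adj) 3≤m {c} u~c c~v i 0<i i<m =
    conclude (G∈ _ _ u≢v u≁v (twoStep u~c c~v) P (twoStep-toll u~c c~v u≁v)
                ((inj , λ j k → mk⇔ (from (adj j k)) (to (adj j k))) , 3≤m)
                (f i) (i , 0<i , i<m , refl))
    where
    P : Walk G (f zero) (f (fromℕ m))
    P = record
      { length = m
      ; vertex = f
      ; start  = refl
      ; end    = refl
      ; step   = λ j → to (adj _ _) (inj₁ (cong suc (toℕ-inject₁ j)))
      }

    0≢m : ∀ {k} → 0 < k → 0 ≢ k
    0≢m () refl

    u≢v : f zero ≢ f (fromℕ m)
    u≢v eq = 0≢m (≤-trans z<s 3≤m) (trans (cong toℕ (inj eq)) (toℕ-fromℕ m))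

    u≁v : ¬ f zero ~ f (fromℕ m)
    u≁v u~v with from (adj _ _) u~v
    ... | inj₁ 1≡m = contradiction (subst (3 ≤_) (sym (trans 1≡m (toℕ-fromℕ m))) 3≤m) λ { (s≤s ()) }

    conclude : (∃ λ y → Internal (twoStep u~c c~v) y × f i ~ y) ⊎ OnWalk (twoStep u~c c~v) (f i) →
      f i ~ c ⊎ f i ≡ c
    conclude (inj₁ (_ , (suc zero , _ , _ , refl) , x~c)) = inj₁ x~c
    conclude (inj₁ (_ , (suc (suc zero) , _ , s≤s (s≤s ()) , _) , _))
    conclude (inj₂ (zero , eq)) = contradiction (cong toℕ (inj eq)) (0≢m 0<i)
    conclude (inj₂ (suc zero , eq)) = inj₂ (sym eq)
    conclude (inj₂ (suc (suc zero) , eq)) =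
      contradiction (trans (sym (cong toℕ (inj eq))) (toℕ-fromℕ m)) (<⇒≢ i<m)

  -- Moving the obstruction inside `H` reduces each forbidden graph to a check on its own edges.
  no-undominated-⊑ : G ∈ TW / m₃ →
    ∀ {h} (H : Graph h) → H ⊑ G → ∀ {m} (e : pathGraph (suc m) ⊑ H) → 3 ≤ m →
    ∀ c → Graph._~_ H (proj₁ e zero) c → Graph._~_ H c (proj₁ e (fromℕ m)) →
    ∀ i → 0 < toℕ i → toℕ i < m → ¬ Graph._~_ H (proj₁ e i) c → proj₁ e i ≢ c → ⊥
  no-undominated-⊑ G∈ H H⊑G@(f , inj , adj) e 3≤m c u~c c~v i 0<i i<m x≁c x≢c =
    [ x≁c ∘ from (adj _ _) , x≢c ∘ inj ]′
      (common-neighbour-dominates G∈ (⊑-trans {F = pathGraph _} {H = H} {G = G} e H⊑G) 3≤m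
        (to (adj _ _) u~c) (to (adj _ _) c~v) i 0<i i<m)

  TW/m₃⇒HHDFree : G ∈ TW / m₃ → HHDFree G
  TW/m₃⇒HHDFree G∈ = no-house , no-hole , no-domino
    where
    no-house : ¬ house ⊑ G
    no-house e = no-undominated-⊑ G∈ house e path⊑house ≤-refl (# 4)
      (from-yes (Graph._~?_ house (# 2) (# 4))) (from-yes (Graph._~?_ house (# 4) (# 1)))
      (# 2) z<s ≤-refl (from-no (Graph._~?_ house (# 3) (# 4))) (λ ())

    no-hole : ∀ k (5≤k : 5 ≤ k) → ¬ hole k 5≤k ⊑ G
    no-hole _ 5≤k@(s≤s (s≤s (s≤s (s≤s (s≤s {n = k} _))))) e =
      -- The path omits the last vertex of the hole, which is adjacent only to vertices 0 and
      -- `3 + k`; vertex 1 is therefore undominated.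
      no-undominated-⊑ G∈ (hole (5 + k) 5≤k) e (path⊑cycle (3 + k) (≤-trans (m≤m+n 3 2) 5≤k))
        (m≤m+n 3 k) (fromℕ (4 + k))
        (inj₂ (inj₁ (refl , refl))) (inj₁ (inj₂ (cong suc (toℕ-inject₁ (fromℕ (3 + k))))))
        (# 1) z<s (s≤s (s≤s z≤n))
        (λ { (inj₁ (inj₁ ())) ; (inj₁ (inj₂ ())) ; (inj₂ (inj₁ (() , _))) ; (inj₂ (inj₂ (() , _))) })
        (λ ())

    no-domino : ¬ domino ⊑ G
    no-domino e = no-undominated-⊑ G∈ domino e path⊑domino (m≤m+n 3 1) (# 1)
      (from-yes (Graph._~?_ domino (# 0) (# 1))) (from-yes (Graph._~?_ domino (# 1) (# 2)))
      (# 1) z<s (s≤s (s≤s z≤n)) (from-no (Graph._~?_ domino (# 5) (# 1))) (λ ())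

  -- Induced paths as sequences of vertices

  infix 4 _#_
  -- Being outside the closed neighbourhood; including distinctness here yields the injectivity of
  -- embeddings built later.
  _#_ : Fin n → Fin n → Set
  a # b = ¬ a ~ b × a ≢ b

  #-sym : ∀ {a b} → a # b → b # a
  #-sym (a≁b , a≢b) = a≁b ∘ ~-sym , a≢b ∘ sym

  ~⇒≢ : ∀ {a b} → a ~ b → a ≢ b
  ~⇒≢ a~b refl = ~-irrefl refl a~b

  -- Only the vertices p 0, …, p m matter.
  record InducedPath (p : ℕ → Fin n) (m : ℕ) : Set where
    field
      edge  : ∀ {k} → k < m → p k ~ p (suc k)
      apart : ∀ {i j} → suc i < j → j ≤ m → p i # p j

  open InducedPath

  cons : Fin n → (ℕ → Fin n) → ℕ → Fin n
  cons a p zero    = a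
  cons a p (suc k) = p k

  InducedPath-cons : ∀ {a p m} → InducedPath p m → a ~ p 0 →
    (∀ {k} → 0 < k → k ≤ m → a # p k) → InducedPath (cons a p) (suc m)
  InducedPath-cons P a~p₀ a# = record
    { edge  = λ { {zero} _ → a~p₀ ; {suc k} (s≤s k<m) → edge P k<m }
    ; apart = λ { {zero}  {suc j} (s≤s 0<j) (s≤s j≤m)  → a# 0<j j≤m
                ; {suc i} {suc j} (s≤s i<j) (s≤s j≤m) → apart P i<j j≤m }
    }

  InducedPath-tail : ∀ {p m} → InducedPath p (suc m) → InducedPath (p ∘ suc) m
  InducedPath-tail P = record
    { edge  = λ k<m → edge P (s≤s k<m)
    ; apart = λ i<j j≤m → apart P (s≤s i<j) (s≤s j≤m)
    }

  InducedPath-take : ∀ {p m} j → j ≤ m → InducedPath p m → InducedPath p j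
  InducedPath-take j j≤m P = record
    { edge  = λ k<j → edge P (≤-trans k<j j≤m)
    ; apart = λ i<k k≤j → apart P i<k (≤-trans k≤j j≤m)
    }

  InducedPath-reverse : ∀ {p m} → InducedPath p m → InducedPath (λ k → p (m ∸ k)) m
  InducedPath-reverse {p} {m} P = record
    { edge  = λ {k} k<m → ~-sym (subst (λ j → p (m ∸ suc k) ~ p j) (sym (∸-step k<m))
                (edge P (subst (_≤ m) (∸-step k<m) (m∸n≤m m k))))
    ; apart = λ {i} {j} 1+i<j j≤m → #-sym (apart P
                (subst (suc (m ∸ j) <_) (sym (∸-step (≤-trans (<⇒≤ 1+i<j) j≤m)))
                  (s≤s (∸-monoʳ-< 1+i<j j≤m)))
                (m∸n≤m m i))
    }
    where
    ∸-step : ∀ {k} → k < m → m ∸ k ≡ suc (m ∸ suc k)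
    ∸-step k<m = +-∸-assoc 1 k<m

  -- Extracting induced paths from walks

  -- Edges of the subgraph induced by `S`: a `Star (Within S)` is a walk inside `S`, except that the
  -- empty walk carries no membership proof.
  Within : (Fin n → Set) → Fin n → Fin n → Set
  Within S a b = a ~ b × S a × S b

  Within-sym : ∀ {S a b} → Within S a b → Within S b a
  Within-sym (a~b , Sa , Sb) = ~-sym a~b , Sb , Sa

  along : ∀ {S a b} (p : ℕ → Fin n) → a ≤′ b → (∀ {k} → a ≤ k → k < b → p k ~ p (suc k)) →
    (∀ {k} → a ≤ k → k ≤ b → S (p k)) → Star (Within S) (p a) (p b)
  along _ ≤′-refl _ _ = ε
  along p (≤′-step a≤′b) step S∋ =
    along p a≤′b (λ a≤k k<b → step a≤k (m<n⇒m<1+n k<b)) (λ a≤k k≤b → S∋ a≤k (m≤n⇒m≤1+n k≤b))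
    ◅◅ (step a≤b ≤-refl , S∋ a≤b (n≤1+n _) , S∋ (m≤n⇒m≤1+n a≤b) ≤-refl) ◅ ε
    where a≤b = ≤′⇒≤ a≤′b

  record InducedPathWithin (S : Fin n → Set) (a b : Fin n) : Set where
    constructor inducedPath
    field
      {path}   : ℕ → Fin n
      {len}    : ℕ
      isInduced : InducedPath path len
      start     : path 0 ≡ a
      end       : path len ≡ b
      within    : ∀ {k} → k ≤ len → S (path k)

  -- The tail is treated first, so the vertex found is the last one equal or adjacent to `a`.
  -- Everything after it is apart from `a`, hence starting there, or prefixing `a`, keeps the path
  -- induced.
  shortcut : ∀ {S a} → S a → ∀ {p} m → InducedPath p m → (∀ {k} → k ≤ m → S (p k)) →
    (∀ {k} → k ≤ m → a # p k) ⊎ InducedPathWithin S a (p m)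
  shortcut-head : ∀ {S a} → S a → ∀ {p} m → InducedPath p m → (∀ {k} → k ≤ m → S (p k)) →
    (∀ {k} → 0 < k → k ≤ m → a # p k) →
    (∀ {k} → k ≤ m → a # p k) ⊎ InducedPathWithin S a (p m)

  shortcut Sa zero    P S∋ = shortcut-head Sa zero P S∋ λ { (s≤s _) () }
  shortcut Sa (suc m) P S∋ with shortcut Sa m (InducedPath-tail P) (S∋ ∘ s≤s)
  ... | inj₁ a#   = shortcut-head Sa (suc m) P S∋ λ { (s≤s _) (s≤s k≤m) → a# k≤m }
  ... | inj₂ path = inj₂ path

  shortcut-head {a = a} Sa {p} m P S∋ a# with a ~? p 0 | a ≟ᶠ p 0
  ... | yes a~p₀ | _        = inj₂ (inducedPath (InducedPath-cons P a~p₀ a#) refl refl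
                                λ { z≤n → Sa ; (s≤s k≤m) → S∋ k≤m })
  ... | no _     | yes refl = inj₂ (inducedPath P refl refl S∋)
  ... | no a≁p₀  | no a≢p₀  = inj₁ λ { {zero} _ → a≁p₀ , a≢p₀ ; {suc k} k≤m → a# z<s k≤m }

  extract : ∀ {S a b} → S a → Star (Within S) a b → InducedPathWithin S a b
  extract Sa ε = inducedPath {path = λ _ → _} {len = 0}
    (record { edge = λ () ; apart = λ { () z≤n } }) refl refl λ _ → Sa
  extract Sa ((a~b , _ , Sb) ◅ walk) with extract Sb walk
  ... | inducedPath {len = m} P refl refl S∋ with shortcut Sa m P S∋
  ...   | inj₁ a#   = contradiction a~b (proj₁ (a# z≤n))
  ...   | inj₂ path = path

  -- Building forbidden subgraphs

  -- Branching on `does` lets each goal for a concrete graph reduce to plain `a ~ b` or `a # b`.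
  Match : ∀ {A : Set} → Dec A → Fin n → Fin n → Set
  Match A? a b = if does A? then a ~ b else a # b

  match : ∀ {A : Set} {a b} (A? : Dec A) → (A → a ~ b) → (¬ A → a # b) → Match A? a b
  match (yes e) adjacent _ = adjacent e
  match (no ¬e) _ apart    = apart ¬e

  -- Each unordered pair is checked once, the smaller index ranging over `Fin (toℕ j)`; symmetry
  -- covers the rest, and both outcomes of `Match` force distinct images.
  ⊑-intro : ∀ {h} (H : Graph h) (f : Fin h → Fin n) →
    (∀ j (i : Fin (toℕ j)) → Match (Graph._~?_ H (inject i) j) (f (inject i)) (f j)) → H ⊑ G
  ⊑-intro {h} H f matches = f , injective , λ i j → mk⇔ (⇒ i j) (⇐ i j)
    where
    module H = Graph H

    Good : Fin h → Fin h → Set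
    Good i j = f i ≢ f j × (i H.~ j → f i ~ f j) × (f i ~ f j → i H.~ j)

    good-inject : ∀ j (i : Fin (toℕ j)) → Good (inject i) j
    good-inject j i with inject i H.~? j | matches j i
    ... | yes e | a~b = ~⇒≢ a~b , (λ _ → a~b) , (λ _ → e)
    ... | no ¬e | (a≁b , a≢b) = a≢b , (λ e → contradiction e ¬e) , (λ a~b → contradiction a~b a≁b)

    good : ∀ {i j} → i F.< j → Good i j
    good {i} {j} i<j = subst (λ k → Good k j)
      (toℕ-injective (trans (toℕ-inject (fromℕ< i<j)) (toℕ-fromℕ< i<j))) (good-inject j (fromℕ< i<j))

    injective : ∀ {i j} → f i ≡ f j → i ≡ j
    injective {i} {j} eq with <ᶠ-cmp i j
    ... | tri< i<j _ _ = contradiction eq (proj₁ (good i<j))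
    ... | tri≈ _ i≡j _ = i≡j
    ... | tri> _ _ j<i = contradiction (sym eq) (proj₁ (good j<i))

    ⇒ : ∀ i j → i H.~ j → f i ~ f j
    ⇒ i j e with <ᶠ-cmp i j
    ... | tri< i<j _ _  = proj₁ (proj₂ (good i<j)) e
    ... | tri≈ _ refl _ = contradiction e (H.~-irrefl refl)
    ... | tri> _ _ j<i  = ~-sym (proj₁ (proj₂ (good j<i)) (H.~-sym e))

    ⇐ : ∀ i j → f i ~ f j → i H.~ j
    ⇐ i j e with <ᶠ-cmp i j
    ... | tri< i<j _ _  = proj₂ (proj₂ (good i<j)) e
    ... | tri≈ _ refl _ = contradiction e (~-irrefl refl)
    ... | tri> _ _ j<i  = H.~-sym (proj₂ (proj₂ (good j<i)) (~-sym e))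

  -- The apex `z` takes index 0 and the path the indices from 1 on, so the closing edge of the cycle
  -- is `z ~ p m`.
  hole-⊑ : ∀ {p m z} (3≤m : 3 ≤ m) → InducedPath p m → z ~ p 0 → z ~ p m →
    (∀ {k} → 0 < k → k < m → z # p k) → hole (2 + m) (s≤s (s≤s 3≤m)) ⊑ G
  hole-⊑ {p} {m} {z} 3≤m P z~p₀ z~pₘ z# = ⊑-intro H (cons z p ∘ toℕ) matches
    where
    H : Graph (2 + m)
    H = hole (2 + m) (s≤s (s≤s 3≤m))

    module H = Graph H

    matches-zero : ∀ (j : Fin (suc m)) → Match (zero H.~? suc j) z (p (toℕ j))
    matches-zero j = match (zero H.~? suc j)
      (λ { (inj₁ (inj₁ 1≡)) → subst (λ k → z ~ p k) (suc-injective 1≡) z~p₀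
         ; (inj₂ (inj₁ (_ , eq))) →
             subst (λ k → z ~ p k) (sym (trans (cong toℕ (sucᶠ-injective eq)) (toℕ-fromℕ m))) z~pₘ })
      λ ¬e → z#
        (n≢0⇒n>0 λ eq → ¬e (inj₁ (inj₁ (cong suc (sym eq)))))
        (≤∧≢⇒< (toℕ≤pred[n] j)
          λ eq → ¬e (inj₂ (inj₁ (refl , cong suc (toℕ-injective (trans eq (sym (toℕ-fromℕ m))))))))

    matches-suc : ∀ (i j : Fin (suc m)) → i F.< j → Match (suc i H.~? suc j) (p (toℕ i)) (p (toℕ j))
    matches-suc i j i<j = match (suc i H.~? suc j)
      (λ { (inj₁ (inj₁ eq)) → subst (λ k → p (toℕ i) ~ p k) (suc-injective eq)
             (edge P (subst (_≤ m) (sym (suc-injective eq)) (toℕ≤pred[n] j)))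
         ; (inj₁ (inj₂ eq)) → contradiction i<j (<-asym (subst (toℕ j <_) (suc-injective eq) ≤-refl))
         ; (inj₂ (inj₁ (() , _))) ; (inj₂ (inj₂ (_ , ()))) })
      λ ¬e → apart P (≤∧≢⇒< i<j λ eq → ¬e (inj₁ (inj₁ (cong suc eq)))) (toℕ≤pred[n] j)

    matches : ∀ (j : Fin (2 + m)) (i : Fin (toℕ j)) →
      Match (inject i H.~? j) (cons z p (toℕ (inject i))) (cons z p (toℕ j))
    matches zero    ()
    matches (suc j) zero    = matches-zero j
    matches (suc j) (suc i) = matches-suc (inject i) j
      (subst (_< toℕ j) (sym (toℕ-inject i)) (toℕ<n i))

  -- A square a b c d together with a roof e on the edge c d.
  house-⊑ : ∀ {a b c d e} → a ~ b → b ~ c → c ~ d → d ~ a → a # c → b # d →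
    e ~ c → e ~ d → a # e → b # e → house ⊑ G
  house-⊑ {a} {b} {c} {d} {e} a~b b~c c~d d~a a#c b#d e~c e~d a#e b#e =
    -- Listed along the induced path of the complement: consecutive vertices are the non-adjacent
    -- pairs.
    ⊑-intro house (lookup (c ∷ a ∷ e ∷ b ∷ d ∷ [])) λ
    { zero ()
    ; (suc zero) zero → #-sym a#c
    ; (suc (suc zero)) zero → ~-sym e~c
    ; (suc (suc zero)) (suc zero) → a#e
    ; (suc (suc (suc zero))) zero → ~-sym b~c
    ; (suc (suc (suc zero))) (suc zero) → a~b
    ; (suc (suc (suc zero))) (suc (suc zero)) → #-sym b#e
    ; (suc (suc (suc (suc zero)))) zero → c~d
    ; (suc (suc (suc (suc zero)))) (suc zero) → ~-sym d~a
    ; (suc (suc (suc (suc zero)))) (suc (suc zero)) → e~d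
    ; (suc (suc (suc (suc zero)))) (suc (suc (suc zero))) → b#d
    }

  -- Squares a b c d and d c e f sharing the edge c d.
  domino-⊑ : ∀ {a b c d e f} → a ~ b → b ~ c → c ~ d → d ~ a → c ~ e → e ~ f → f ~ d →
    a # c → b # d → a # e → a # f → b # e → b # f → c # f → d # e → domino ⊑ G
  domino-⊑ {a} {b} {c} {d} {e} {f} a~b b~c c~d d~a c~e e~f f~d a#c b#d a#e a#f b#e b#f c#f d#e =
    -- Listed around the outer six-cycle, with `c` and `d` at positions 1 and 4 of the chord.
    ⊑-intro domino (lookup (b ∷ c ∷ e ∷ f ∷ d ∷ a ∷ [])) λ
    { zero ()
    ; (suc zero) zero → b~c
    ; (suc (suc zero)) zero → b#e
    ; (suc (suc zero)) (suc zero) → c~e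
    ; (suc (suc (suc zero))) zero → b#f
    ; (suc (suc (suc zero))) (suc zero) → c#f
    ; (suc (suc (suc zero))) (suc (suc zero)) → e~f
    ; (suc (suc (suc (suc zero)))) zero → b#d
    ; (suc (suc (suc (suc zero)))) (suc zero) → c~d
    ; (suc (suc (suc (suc zero)))) (suc (suc zero)) → #-sym d#e
    ; (suc (suc (suc (suc zero)))) (suc (suc (suc zero))) → f~d
    ; (suc (suc (suc (suc (suc zero))))) zero → ~-sym a~b
    ; (suc (suc (suc (suc (suc zero))))) (suc zero) → #-sym a#c
    ; (suc (suc (suc (suc (suc zero))))) (suc (suc zero)) → #-sym a#e
    ; (suc (suc (suc (suc (suc zero))))) (suc (suc (suc zero))) → #-sym a#f
    ; (suc (suc (suc (suc (suc zero))))) (suc (suc (suc (suc zero)))) → d~a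
    }

  -- HHD-free graphs

  module _ (no-house : ¬ house ⊑ G) (no-hole : ∀ k (5≤k : 5 ≤ k) → ¬ hole k 5≤k ⊑ G)
           (no-domino : ¬ domino ⊑ G) where

    -- Here p is the path r of the header, w = p 0 and t = p (2 + m).
    no-induced-detour : ∀ {p m x y} → InducedPath p (2 + m) →
      p 0 ~ x → x ~ y → p 0 # y → y ~ p (2 + m) → (∀ {k} → 0 < k → k ≤ 2 + m → x # p k) → ⊥
    no-induced-detour {p} {m} {x} {y} P w~x x~y w#y y~t x# =
      case-first (least (λ k → y ~? p k) y~t)
      where
      -- `x` is adjacent to `y` but to no path vertex after `p 0`.
      y≢ : ∀ {k} → 0 < k → k ≤ 2 + m → y ≢ p k
      y≢ 0<k k≤m refl = proj₁ (x# 0<k k≤m) x~y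

      second : y ~ p 1 → ⊥
      -- The search starts at `p 2`, so index 0 means `p 2` (house), index 1 means `p 3` (domino),
      -- and a later index closes a hole through `y` and `p 1`.
      second y~p₁ with least {m = m} (λ k → y ~? p (2 + k)) y~t
      ... | zero , _ , y~p₂ , _ = no-house (house-⊑
        w~x x~y y~p₁ (~-sym (edge P z<s)) w#y (x# z<s (s≤s z≤n))
        (~-sym y~p₂) (~-sym (edge P (s≤s z<s))) (apart P ≤-refl (s≤s (s≤s z≤n))) (x# z<s (s≤s (s≤s z≤n))))
      ... | suc zero , 1≤m , y~p₃ , y≁ = no-domino (domino-⊑
        w~x x~y y~p₁ (~-sym (edge P z<s)) y~p₃ (~-sym (edge P (s≤s (s≤s 1≤m)))) (~-sym (edge P (s≤s z<s)))
        w#y (x# z<s (s≤s z≤n)) (apart P (s≤s z<s) 3≤) (apart P ≤-refl 2≤)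
        (x# z<s 3≤) (x# z<s 2≤) (y≁ z<s , y≢ z<s 2≤) (apart P ≤-refl 3≤))
        where
        3≤ : 3 ≤ 2 + m
        3≤ = s≤s (s≤s 1≤m)
        2≤ : 2 ≤ 2 + m
        2≤ = s≤s (s≤s z≤n)
      ... | suc (suc j) , j≤m , y~pⱼ , y≁ = no-hole _ (s≤s (s≤s (m≤m+n 3 j)))
        (hole-⊑ {m = 3 + j} (m≤m+n 3 j) (InducedPath-take _ (s≤s j≤m) (InducedPath-tail P)) y~p₁ y~pⱼ
          λ { {suc k} _ (s≤s k<) → y≁ k< , y≢ z<s (≤-trans (s≤s k<) (s≤s (≤-trans j≤m (n≤1+n m)))) })

      case-first : (∃ λ j → j ≤ 2 + m × y ~ p j × (∀ {k} → k < j → ¬ y ~ p k)) → ⊥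
      case-first (zero , _ , y~w , _) = proj₁ w#y (~-sym y~w)
      case-first (suc zero , _ , y~p₁ , _) = second y~p₁
      -- The hole consists of `y`, `x` and the path from `p 0` to `p (2 + j)`.
      case-first (suc (suc j) , j≤m , y~pⱼ , y≁) = no-hole _ (s≤s (s≤s (m≤m+n 3 j)))
        (hole-⊑ {m = 3 + j} (m≤m+n 3 j)
          (InducedPath-cons (InducedPath-take _ j≤m P) (~-sym w~x) λ 0<k k≤j → x# 0<k (≤-trans k≤j j≤m))
          (~-sym x~y) y~pⱼ
          λ { {suc zero} _ _ → #-sym w#y
            ; {suc (suc k)} _ (s≤s k<) → y≁ k< , y≢ z<s (≤-trans (<⇒≤ k<) j≤m) })

    -- The walk may return to `w`, but the induced path extracted from it meets `w` only at its
    -- start, so all its later vertices are apart from `x`. The other hypotheses exclude lengths 0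
    -- and 1.
    no-detour : ∀ {w x y t} → w ~ x → x ~ y → y ~ t → w # y → ¬ w ~ t →
      Star (Within λ z → z ≡ w ⊎ x # z) w t → ⊥
    no-detour {w} {x} w~x x~y y~t w#y w≁t walk with extract (inj₁ refl) walk
    ... | inducedPath {len = zero}        P refl refl S∋ = proj₁ w#y (~-sym y~t)
    ... | inducedPath {len = suc zero}    P refl refl S∋ = w≁t (edge P z<s)
    ... | inducedPath {p} {suc (suc m)}   P refl refl S∋ =
      no-induced-detour P w~x x~y w#y y~t avoids
      where
      avoids : ∀ {k} → 0 < k → k ≤ 2 + m → x # p k
      avoids {suc k} _ k≤m with S∋ k≤m
      ... | inj₂ x#pₖ = x#pₖ
      avoids {suc zero}    _ k≤m | inj₁ eq = contradiction (sym eq) (~⇒≢ (edge P z<s))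
      avoids {suc (suc k)} _ k≤m | inj₁ eq = contradiction (sym eq) (proj₂ (apart P (s≤s z<s) k≤m))

    -- The ends are exempt because domination speaks only of internal vertices of the walk, and `x`
    -- may be adjacent to an end.
    Avoiding : Fin n → Fin n → Fin n → Fin n → Set
    Avoiding u v x z = z ≡ u ⊎ z ≡ v ⊎ x # z

    -- Here `x`, `w`, `y`, `t` are `q` at `1 + i`, `i`, `2 + i`, `3 + i`. The exempt ends do no
    -- harm: `q 0` is `w` or apart from `x`, and `q l` is apart from `x` since `3 + i ≤ l`.
    no-undominated-right : ∀ {q l} i → InducedPath q l → 3 + i ≤ l →
      Star (Within (Avoiding (q 0) (q l) (q (suc i)))) (q 0) (q l) → ⊥
    no-undominated-right {q} {l} i Q 3+i≤l walk =
      no-detour (edge Q 1+i≤l) (edge Q 2+i≤l) (edge Q 3+i≤l)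
        (apart Q ≤-refl 2+i≤l) (proj₁ (apart Q (s≤s (n≤1+n _)) 3+i≤l))
        (reverse Within-sym (along q (≤⇒≤′ z≤n) (λ _ k<i → edge Q (≤-trans k<i (<⇒≤ 1+i≤l)))
          (λ _ → before))
         ◅◅ map widen walk
         ◅◅ reverse Within-sym (along q (≤⇒≤′ 3+i≤l) (λ _ → edge Q) after))
      where
      1+i≤l : suc i ≤ l
      1+i≤l = ≤-trans (m≤n+m (suc i) 2) 3+i≤l
      2+i≤l : 2 + i ≤ l
      2+i≤l = <⇒≤ 3+i≤l

      S : Fin n → Set
      S z = z ≡ q i ⊎ q (suc i) # z

      before : ∀ {k} → k ≤ i → S (q k)
      before {k} k≤i with k ≟ i
      ... | yes refl = inj₁ refl
      ... | no k≢i   = inj₂ (#-sym (apart Q (s≤s (≤∧≢⇒< k≤i k≢i)) 1+i≤l))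

      after : ∀ {k} → 3 + i ≤ k → k ≤ l → S (q k)
      after 3+i≤k k≤l = inj₂ (apart Q 3+i≤k k≤l)

      widen : ∀ {a b} → Within (Avoiding (q 0) (q l) (q (suc i))) a b → Within S a b
      widen (a~b , Aa , Ab) = a~b , widen′ Aa , widen′ Ab
        where
        widen′ : ∀ {z} → Avoiding (q 0) (q l) (q (suc i)) z → S z
        widen′ (inj₁ refl)        = before z≤n
        widen′ (inj₂ (inj₁ refl)) = after 3+i≤l ≤-refl
        widen′ (inj₂ (inj₂ x#z))  = inj₂ x#z

    no-undominated : ∀ {q l u v x} k → InducedPath q l → 3 ≤ l → q 0 ≡ u → q l ≡ v → q k ≡ x →
      0 < k → k < l → Star (Within (Avoiding u v x)) u v → ⊥
    no-undominated {q} {suc (suc (suc l))} (suc i) Q (s≤s (s≤s (s≤s z≤n))) refl refl refl _ (s≤s (s≤s i≤1+l)) walk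
      with i ≤? l
    ... | yes i≤l = no-undominated-right i Q (s≤s (s≤s (s≤s i≤l))) walk
    ... | no i≰l with ≤-antisym i≤1+l (≰⇒> i≰l)
    -- Now `x` is the last internal vertex; reversal puts it at position 1, with at least two
    -- vertices after it.
    ...   | refl = no-undominated-right 0 (InducedPath-reverse Q) (m≤m+n 3 l)
      (subst (λ k → Star (Within (Avoiding (q (3 + l)) (q k) (q (2 + l)))) (q (3 + l)) (q k))
        (sym (n∸n≡0 l))
        (map (λ (a~b , Aa , Ab) → a~b , swap Aa , swap Ab) (reverse Within-sym walk)))
      where
      swap : ∀ {z u v x} → Avoiding u v x z → Avoiding v u x z
      swap = [ inj₂ ∘ inj₁ , [ inj₁ , inj₂ ∘ inj₂ ]′ ]′

  -- Walks read as sequences indexed by natural numbers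

  open Walk

  -- Indices beyond `l` are clamped to the last position, giving the total sequences that
  -- `InducedPath` expects.
  position : ∀ l → ℕ → Fin (suc l)
  position l       zero    = zero
  position zero    (suc k) = zero
  position (suc l) (suc k) = suc (position l k)

  position-toℕ : ∀ {l} (i : Fin (suc l)) → position l (toℕ i) ≡ i
  position-toℕ         zero    = refl
  position-toℕ {suc l} (suc i) = cong suc (position-toℕ i)

  toℕ-position : ∀ {l k} → k ≤ l → toℕ (position l k) ≡ k
  toℕ-position z≤n       = refl
  toℕ-position (s≤s k≤l) = cong suc (toℕ-position k≤l)

  position-fromℕ : ∀ l → position l l ≡ fromℕ l
  position-fromℕ zero    = refl
  position-fromℕ (suc l) = cong suc (position-fromℕ l)

  at : ∀ {u v} → Walk G u v → ℕ → Fin n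
  at W k = vertex W (position (length W) k)

  at-end : ∀ {u v} (W : Walk G u v) → at W (length W) ≡ v
  at-end W = trans (cong (vertex W) (position-fromℕ _)) (end W)

  at-step : ∀ {u v} (W : Walk G u v) {k} → k < length W → at W k ~ at W (suc k)
  at-step W {k} k<l = subst₂ _~_
    (cong (vertex W) (toℕ-injective
      (trans (toℕ-inject₁ i) (trans (toℕ-fromℕ< k<l) (sym (toℕ-position (<⇒≤ k<l)))))))
    (cong (vertex W) (toℕ-injective (trans (cong suc (toℕ-fromℕ< k<l)) (sym (toℕ-position k<l)))))
    (step W i)
    where i = fromℕ< k<l

  at-InducedPath : ∀ {u v} (W : Walk G u v) → IsInducedPath W → InducedPath (at W) (length W)
  at-InducedPath W (inj , adj) = record
    { edge  = at-step W
    ; apart = λ {i} {j} 1+i<j j≤l →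
        let pᵢ = toℕ-position (≤-trans (<⇒≤ (<⇒≤ 1+i<j)) j≤l)
            pⱼ = toℕ-position j≤l
        in (λ i~j → [ (λ eq → <⇒≢ 1+i<j (subst₂ (λ a b → suc a ≡ b) pᵢ pⱼ eq))
                    , (λ eq → <⇒≢ (m<n⇒m<1+n (<⇒≤ 1+i<j)) (sym (subst₂ (λ a b → suc b ≡ a) pᵢ pⱼ eq)))
                    ]′ (to (adj _ _) i~j))
         , λ eq → <⇒≢ (<⇒≤ 1+i<j) (trans (sym pᵢ) (trans (cong toℕ (inj eq)) pⱼ))
    }

  walk-within : ∀ {u v S} (W : Walk G u v) → S u → S v → (∀ x → Internal W x → S x) →
    Star (Within S) u v
  walk-within {u} {v} {S} W Su Sv internal = subst₂ (Star (Within S)) (start W) (at-end W)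
    (along (at W) (≤⇒≤′ z≤n) (λ _ → at-step W) (λ _ → S∋))
    where
    S∋ : ∀ {k} → k ≤ length W → S (at W k)
    S∋ {zero}  _   = subst S (sym (start W)) Su
    S∋ {suc k} k<l with suc k ≟ length W
    ... | yes refl = subst S (sym (at-end W)) Sv
    ... | no k≢l   = internal _ (position (length W) (suc k) ,
      subst (0 <_) (sym p) z<s , subst (_< length W) (sym p) (≤∧≢⇒< k<l k≢l) , refl)
      where p = toℕ-position k<l

  HHDFree⇒WTW/m₃ : HHDFree G → G ∈ WTW / m₃
  HHDFree⇒WTW/m₃ (no-house , no-hole , no-domino) u v _ _ W Q _ (induced , 3≤l) x (i , 0<i , i<l , refl) =
    decide (any? λ y → internal? y ×-dec x ~? y) (any? λ j → vertex W j ≟ᶠ x)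
    where
    internal? : ∀ y → Dec (Internal W y)
    internal? y = any? λ j → (0 <? toℕ j) ×-dec (toℕ j <? length W) ×-dec (vertex W j ≟ᶠ y)

    decide : Dec (∃ λ y → Internal W y × x ~ y) → Dec (OnWalk W x) →
      (∃ λ y → Internal W y × x ~ y) ⊎ OnWalk W x
    decide (yes dominated) _             = inj₁ dominated
    decide (no _)          (yes on-walk) = inj₂ on-walk
    -- Failure of both alternatives makes `x` apart from every internal vertex of `W`, so `W` runs
    -- inside `Avoiding u v x`.
    decide (no ¬dominated) (no ¬on-walk) = ⊥-elim
      (no-undominated no-house no-hole no-domino (toℕ i) (at-InducedPath Q induced) 3≤l
        (start Q) (at-end Q) (cong (vertex Q) (position-toℕ i)) 0<i i<l
        (walk-within W (inj₁ refl) (inj₂ (inj₁ refl)) λ y Iy@(j , _ , _ , eq) →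
          inj₂ (inj₂ ((λ x~y → ¬dominated (y , Iy , x~y)) , λ x≡y → ¬on-walk (j , trans eq (sym x≡y))))))

corollary4 : (n : ℕ) (G : Graph n) → Connected G →
    (G ∈ WTW / m₃ ⇔ G ∈ TW / m₃) × (G ∈ TW / m₃ ⇔ HHDFree G)
corollary4 n G _ =
  mk⇔ WTW⇒TW (HHDFree⇒WTW/m₃ ∘ TW/m₃⇒HHDFree) ,
  mk⇔ TW/m₃⇒HHDFree (WTW⇒TW ∘ HHDFree⇒WTW/m₃)
  where
  -- Toll walks are weakly toll, so fewer walks have to dominate.
  WTW⇒TW : G ∈ WTW / m₃ → G ∈ TW / m₃
  WTW⇒TW G∈ u v u≢v u≁v W W′ (weakly-toll , _) = G∈ u v u≢v u≁v W W′ weakly-toll
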